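{- For every integer $n \geq 1$, \[ \sum_{\sigma\in\mathcal{Q}_n} x^{\operatorname{ap}(\sigma)}(-1)^{\operatorname{even}(\sigma)} = \sum_{\pi\in \overline{\mathfrak{S}}_n}x^{\operatorname{asc}(\pi)}(-1)^{\operatorname{mark}(\pi)} = 1. \]
   Context: Let $[n]_2$ be the multiset $\{1,1,2,2,\dots,n,n\}$. A Stirling permutation of order $n$ is a permutation $\sigma=\sigma_1\cdots\sigma_{2n}$ of $[n]_2$ such that for each $i\in[n]$ every entry between the two occurrences of $i$ is greater than $i$; $\mathcal{Q}_n$ denotes the set of these. An ascent plateau of $\sigma$ is an entry $\sigma_i$ with $2\le i\le 2n-1$ and $\sigma_{i-1}<\sigma_i=\sigma_{i+1}$; $\operatorname{ap}(\sigma)$ is their number. An entry $k$ of $\sigma$ is even indexed if the first occurrence of $k$ is at an even position; $\operatorname{even}(\sigma)$ is the number of even indexed values. A left-to-right minimum of a permutation $\pi=\pi_1\cdots\pi_n$ is an entry $\pi_i$ with $i=1$ or $\pi_i<\pi_j$ for all $j<i$. A marked permutation of $[n]$ is a permutation of $[n]$ together with marks on some (possibly none) of its entries that are not left-to-right minima; $\overline{\mathfrak{S}}_n$ is the set of marked permutations of $[n]$. For $\pi\in\overline{\mathfrak{S}}_n$, $\operatorname{mark}(\pi)$ is the number of marked entries and $\operatorname{asc}(\pi)$ is the number of $i\in\{2,\dots,n\}$ with $\pi_i>\pi_{i-1}$ (marks ignored). -}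

module Defs where

open import Algebra.Bundles using (CommutativeRing)
open import Data.Bool.Base using (Bool; true; false; if_then_else_; T)
open import Data.Bool.Properties using (T?)
open import Data.Fin.Base as Fin using (Fin)
import Data.Fin.Properties as Fin
open import Data.List.Base
  using (List; []; _∷_; _++_; map; concatMap; filter; foldr; length; lookup;
         upTo; cartesianProduct; cartesianProductWith)
open import Data.List.Membership.DecPropositional using () renaming (_∈?_ to member?)
open import Data.List.Membership.Propositional.Properties using (∈-∃++)
open import Data.List.Relation.Binary.Permutation.Propositional
  using (_↭_; ↭-refl; ↭-sym; ↭-trans; prep)
open import Data.List.Relation.Binary.Permutation.Propositional.Properties
  using (shift; drop-∷; ∈-resp-↭; ¬x∷xs↭[])
open import Data.List.Relation.Unary.Any using (here)
open import Data.Nat.Base using (ℕ; zero; suc; _+_; _*_; _<_)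
open import Data.Nat.Divisibility using (_∣_; _∣?_)
open import Data.Nat.Properties using (_≟_; _<?_)
open import Data.Product.Base using (_×_; _,_; proj₁; proj₂)
open import Function.Base using (_∘_)
open import Relation.Binary.PropositionalEquality using (_≡_; refl)
open import Relation.Nullary.Decidable
  using (Dec; yes; no; does; map′; ¬?; _×-dec_; _→-dec_)
open import Relation.Nullary.Negation using (¬_)

[_] : ℕ → List ℕ
[ n ] = map suc (upTo n)

[_]₂ : ℕ → List ℕ
[ n ]₂ = concatMap (λ i → i ∷ i ∷ []) [ n ]

words : ∀ {A : Set} → List A → ℕ → List (List A)
words alphabet zero    = [] ∷ []
words alphabet (suc m) = cartesianProductWith _∷_ alphabet (words alphabet m)

infix 4 _↭?_

_↭?_ : (xs ys : List ℕ) → Dec (xs ↭ ys)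
[]       ↭? []       = yes ↭-refl
[]       ↭? (y ∷ ys) = no (¬x∷xs↭[] ∘ ↭-sym)
(x ∷ xs) ↭? ys with member? _≟_ x ys
... | no x∉ys = no λ p → x∉ys (∈-resp-↭ p (here refl))
... | yes x∈ys with ∈-∃++ x∈ys
...   | us , vs , refl = map′
        (λ p → ↭-trans (prep x p) (↭-sym (shift x us vs)))
        (λ p → drop-∷ (↭-trans p (shift x us vs)))
        (xs ↭? (us ++ vs))

-- In a permutation of [ n ]₂, positions a < c carrying equal entries are the
-- two occurrences of that entry.
IsStirling : ℕ → List ℕ → Set
IsStirling n σ = σ ↭ [ n ]₂ ×
  (∀ (a b c : Fin (length σ)) → a Fin.< b → b Fin.< c →
     lookup σ a ≡ lookup σ c → lookup σ a < lookup σ b)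

isStirling? : ∀ n σ → Dec (IsStirling n σ)
isStirling? n σ = (σ ↭? [ n ]₂) ×-dec
  Fin.all? λ a → Fin.all? λ b → Fin.all? λ c →
    (a Fin.<? b) →-dec ((b Fin.<? c) →-dec
    ((lookup σ a ≟ lookup σ c) →-dec (lookup σ a <? lookup σ b)))

-- As `words` over a duplicate-free alphabet has no repetitions, each Stirling
-- permutation is listed exactly once.
𝒬 : ℕ → List (List ℕ)
𝒬 n = filter (isStirling? n) (words [ n ] (2 * n))

ap : List ℕ → ℕ
ap (x ∷ σ@(y ∷ z ∷ _)) =
  (if does ((x <? y) ×-dec (y ≟ z)) then 1 else 0) + ap σ
ap _ = 0

-- Positions are counted from 1; the value is meaningful only if k occurs.
firstPosition : ℕ → List ℕ → ℕ
firstPosition k []      = 1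
firstPosition k (x ∷ σ) = if does (x ≟ k) then 1 else suc (firstPosition k σ)

EvenIndexed : List ℕ → ℕ → Set
EvenIndexed σ k = 2 ∣ firstPosition k σ

evenIndexed? : ∀ σ k → Dec (EvenIndexed σ k)
evenIndexed? σ k = 2 ∣? firstPosition k σ

even : ℕ → List ℕ → ℕ
even n σ = length (filter (evenIndexed? σ) [ n ])

-- A word of entries, each paired with a flag telling whether it is marked.
MarkedWord : Set
MarkedWord = List (ℕ × Bool)

entry : (π : MarkedWord) → Fin (length π) → ℕ
entry π i = proj₁ (lookup π i)

Marked : (π : MarkedWord) → Fin (length π) → Set
Marked π i = T (proj₂ (lookup π i))

IsLeftToRightMinimum : (π : MarkedWord) → Fin (length π) → Set
IsLeftToRightMinimum π i = ∀ j → j Fin.< i → entry π i < entry π j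

isLeftToRightMinimum? : ∀ π i → Dec (IsLeftToRightMinimum π i)
isLeftToRightMinimum? π i =
  Fin.all? λ j → (j Fin.<? i) →-dec (entry π i <? entry π j)

IsMarkedPermutation : ℕ → MarkedWord → Set
IsMarkedPermutation n π = map proj₁ π ↭ [ n ] ×
  (∀ i → Marked π i → ¬ IsLeftToRightMinimum π i)

isMarkedPermutation? : ∀ n π → Dec (IsMarkedPermutation n π)
isMarkedPermutation? n π = (map proj₁ π ↭? [ n ]) ×-dec
  Fin.all? λ i → T? (proj₂ (lookup π i)) →-dec ¬? (isLeftToRightMinimum? π i)

𝔖̄ : ℕ → List MarkedWord
𝔖̄ n = filter (isMarkedPermutation? n)
  (words (cartesianProduct [ n ] (false ∷ true ∷ [])) n)

mark : MarkedWord → ℕ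
mark π = length (filter (T? ∘ proj₂) π)

ascents : List ℕ → ℕ
ascents (x ∷ π@(y ∷ _)) = (if does (x <? y) then 1 else 0) + ascents π
ascents _ = 0

asc : MarkedWord → ℕ
asc π = ascents (map proj₁ π)

-- An identity between polynomials in x with integer coefficients is stated as
-- an identity for every element x of every commutative ring R; the case
-- R = ℤ[x] is the identity of formal polynomials.
module RingNotation {c ℓ} (R : CommutativeRing c ℓ) where

  open CommutativeRing R public
    using (Carrier; _≈_; 0#; 1#; -_)
    renaming (_+_ to _+ᴿ_; _*_ to _·_)
  open import Algebra.Properties.Semiring.Exp (CommutativeRing.semiring R) public
    using (_^_)

  ∑ : ∀ {A : Set} → List A → (A → Carrier) → Carrier
  ∑ xs f = foldr (λ a s → f a +ᴿ s) 0# xs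

  syntax ∑ xs (λ a → e) = ∑[ a ∈ xs ] e

-- Both sums are 1 by induction on n, inserting the largest value m = n + 1.
-- Inserting the block m m into a Stirling permutation σ of order n shifts later
-- entries by two, so parities of positions are kept and the sign changes only by
-- the parity of the new block's position. A block that is not put first creates a
-- plateau at m and destroys one exactly when it splits that plateau or the ascent
-- into it. As these two gaps are adjacent, the alternating
-- sum over the 2n + 1 gaps collapses to the weight of σ.
-- Inserting m into a marked permutation at a place other than the first gives two
-- choices of mark, which cancel; put first, m must be unmarked and keeps the weight.
module Submission where

open import Defs
open import Algebra.Bundles using (CommutativeRing)
open import Data.Bool.Base using (Bool; true; false; T; if_then_else_)
open import Data.Empty using (⊥-elim)
open import Data.Fin.Base as Fin using (Fin)
open import Data.List.Base
  using (List; []; _∷_; _++_; map; concatMap; filter; length; lookup; upTo; cartesianProduct)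
open import Data.List.Membership.Propositional using (_∈_; _∉_; find; lose)
open import Data.List.Membership.Propositional.Properties
  using (∈-map⁺; ∈-map⁻; ∈-++⁺ˡ; ∈-++⁺ʳ; ∈-++⁻; ∈-insert; ∈-∃++; ∈-concatMap⁺; ∈-concatMap⁻;
         ∈-cartesianProduct⁺; ∈-cartesianProductWith⁺; ∈-filter⁺; ∈-filter⁻)
open import Data.List.Membership.Propositional.Properties.WithK using (unique∧set⇒bag)
open import Data.List.Properties
  using (++-assoc; concatMap-++; map-++; upTo-∷ʳ; ∷-injectiveʳ; ∷-injective; filter-++;
         filter-all; filter-none; length-++; length-map; length-upTo)
open import Data.List.Relation.Binary.BagAndSetEquality using (∼bag⇒↭)
open import Data.List.Relation.Binary.Permutation.Propositional
  using (_↭_; ↭-reflexive; ↭-sym; ↭-trans; prep)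
open import Data.List.Relation.Binary.Permutation.Propositional.Properties
  using (shift; shifts; drop-∷; ∈-resp-↭; All-resp-↭; ↭-length; ++-comm)
import Data.List.Relation.Binary.Permutation.Propositional.Properties as ↭
open import Data.List.Relation.Binary.Sublist.Propositional
  using (_⊆_; []; _∷_; _∷ʳ_; minimum; from∈; to∈; ⊆-refl; ⊆-trans)
import Data.List.Relation.Binary.Sublist.Propositional.Properties as Sublist
open import Data.List.Relation.Unary.All as All using (All; []; _∷_)
import Data.List.Relation.Unary.All.Properties as All
open import Data.List.Relation.Unary.AllPairs using ([]; _∷_)
open import Data.List.Relation.Unary.Any using (here; there)
open import Data.List.Relation.Unary.Unique.Propositional using (Unique)
import Data.List.Relation.Unary.Unique.Propositional.Properties as Unique
open import Data.Nat.Base using (ℕ; zero; suc; _+_; _*_; _≤_; _<_; _≥_; z≤n; s≤s; s≤s⁻¹)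
open import Data.Nat.Divisibility using (_∣?_; ∣-refl; ∣m∣n⇒∣m+n; ∣m+n∣m⇒∣n)
open import Data.Nat.Properties
  using (_≟_; <-irrefl; <-asym; _<?_; <⇒≢; <⇒≱; m≤n⇒m≤1+n; ≤-refl; suc-injective; *-comm)
open import Data.Product.Base using (_×_; _,_; proj₁; proj₂; ∃; ∃₂)
open import Data.Sum.Base using (_⊎_; inj₁; inj₂)
open import Data.Unit.Base using (⊤; tt)
open import Function.Base using (_∘_; id; case_of_)
open import Function.Bundles using (mk⇔)
open import Level using (0ℓ)
open import Relation.Binary.PropositionalEquality
  using (_≡_; _≢_; refl; sym; trans; cong; cong₂; subst; subst₂; module ≡-Reasoning)
open import Relation.Nullary.Decidable using (yes; no; does; ¬?; _×-dec_; dec-true; dec-false; does-⇔)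
open import Relation.Nullary.Negation using (¬_; contradiction)
open import Relation.Unary using (Pred; Decidable)

private variable
  A B : Set

-- Fibrewise enumeration

-- Every child determines its parent, so the lists of children of distinct elements are disjoint.
concatMap-unique : {xs : List A} (children : A → List B) (parent : B → A) →
  Unique xs → (∀ {x} → x ∈ xs → Unique (children x)) →
  (∀ {x y} → x ∈ xs → y ∈ children x → parent y ≡ x) →
  Unique (concatMap children xs)
concatMap-unique children parent []          _       _   = []
concatMap-unique {xs = x ∷ xs} children parent u@(_ ∷ uniq) uniqᶜ par =
  Unique.++⁺ (uniqᶜ (here refl))
    (concatMap-unique children parent uniq (uniqᶜ ∘ there) (par ∘ there))
    λ { (y∈x , y∈xs) →
      let x′ , x′∈xs , y∈x′ = find (∈-concatMap⁻ children y∈xs)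
          x≡x′ = trans (sym (par (here refl) y∈x)) (par (there x′∈xs) y∈x′)
      in Unique.Unique[x∷xs]⇒x∉xs u (subst (_∈ xs) (sym x≡x′) x′∈xs) }

-- Duplicate-free lists with the same members are permutations of each other. This reduces each
-- recursive enumeration below to soundness, completeness and a map recovering the parent.
↭-concatMap : {xs : List A} {ys : List B} (children : A → List B) (parent : B → A) →
  Unique xs → Unique ys → (∀ {x} → x ∈ xs → Unique (children x)) →
  (∀ {x y} → x ∈ xs → y ∈ children x → parent y ≡ x) →
  (∀ {x y} → x ∈ xs → y ∈ children x → y ∈ ys) →
  (∀ {y} → y ∈ ys → ∃ λ x → x ∈ xs × y ∈ children x) →
  ys ↭ concatMap children xs
↭-concatMap children parent uniqˣ uniqʸ uniqᶜ par sound complete =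
  ∼bag⇒↭ (unique∧set⇒bag uniqʸ (concatMap-unique children parent uniqˣ uniqᶜ par)
    (mk⇔ (λ y∈ → let _ , x∈ , y∈x = complete y∈ in ∈-concatMap⁺ children (lose x∈ y∈x))
         (λ y∈ → let _ , x∈ , y∈x = find (∈-concatMap⁻ children y∈) in sound x∈ y∈x)))

words-unique : {xs : List A} → Unique xs → ∀ k → Unique (words xs k)
words-unique uniq zero    = [] ∷ []
words-unique uniq (suc k) =
  Unique.cartesianProductWith⁺ _∷_ ∷-injective uniq (words-unique uniq k)

∈-words : {xs w : List A} → All (_∈ xs) w → w ∈ words xs (length w)
∈-words []            = here refl
∈-words (x∈xs ∷ w∈xs) = ∈-cartesianProductWith⁺ _∷_ x∈xs (∈-words w∈xs)

-- Insertion of a block into a word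

-- The front gap is kept apart because a maximal entry placed there must stay unmarked.
insertions laterInsertions : List A → List A → List (List A)
insertions b xs = (b ++ xs) ∷ laterInsertions b xs
laterInsertions b []       = []
laterInsertions b (x ∷ xs) = map (x ∷_) (insertions b xs)

∈-insertions⁺ : (us b vs : List A) → us ++ b ++ vs ∈ insertions b (us ++ vs)
∈-insertions⁺ []       b vs = here refl
∈-insertions⁺ (u ∷ us) b vs = there (∈-map⁺ (u ∷_) (∈-insertions⁺ us b vs))

∈-insertions⁻ : (b : List A) {xs w : List A} → w ∈ insertions b xs →
  ∃₂ λ us vs → xs ≡ us ++ vs × w ≡ us ++ b ++ vs
∈-insertions⁻ b {xs}     (here refl) = [] , xs , refl , refl
∈-insertions⁻ b {x ∷ xs} (there w∈) with ∈-map⁻ (x ∷_) w∈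
... | _ , w∈ , refl with ∈-insertions⁻ b w∈
... | us , vs , refl , refl = x ∷ us , vs , refl , refl

∈-laterInsertions⁻ : (b : List A) {xs w : List A} → w ∈ laterInsertions b xs →
  ∃₂ λ u us → ∃ λ vs → xs ≡ u ∷ us ++ vs × w ≡ u ∷ us ++ b ++ vs
∈-laterInsertions⁻ b {x ∷ xs} w∈ with ∈-map⁻ (x ∷_) w∈
... | _ , w∈ , refl with ∈-insertions⁻ b w∈
... | us , vs , refl , refl = x , us , vs , refl , refl

-- Only the insertion at the front begins with the new letter `c`; the others begin with an old
-- letter, which induction strips off.
insertions-unique : ∀ {c cs} {xs : List A} → c ∉ xs → Unique (insertions (c ∷ cs) xs)
insertions-unique {xs = []}     _  = [] ∷ []
insertions-unique {xs = x ∷ xs} c∉ =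
  All.tabulate (λ w∈ eq → case ∈-map⁻ (x ∷_) w∈ of λ where
    (_ , _ , refl) → c∉ (here (proj₁ (∷-injective eq))))
  ∷ Unique.map⁺ ∷-injectiveʳ (insertions-unique (c∉ ∘ there))

filter-block : {P : Pred A 0ℓ} (P? : Decidable P) (us : List A) {b vs : List A} →
  All P (us ++ vs) → All (¬_ ∘ P) b → filter P? (us ++ b ++ vs) ≡ us ++ vs
filter-block P? us {b} {vs} keep drop = begin
  filter P? (us ++ b ++ vs)                       ≡⟨ filter-++ P? us (b ++ vs) ⟩
  filter P? us ++ filter P? (b ++ vs)             ≡⟨ cong (filter P? us ++_) (filter-++ P? b vs) ⟩
  filter P? us ++ filter P? b ++ filter P? vs     ≡⟨ cong (λ w → filter P? us ++ w ++ filter P? vs) (filter-none P? drop) ⟩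
  filter P? us ++ filter P? vs                    ≡⟨ filter-++ P? us vs ⟨
  filter P? (us ++ vs)                            ≡⟨ filter-all P? keep ⟩
  us ++ vs                                        ∎
  where open ≡-Reasoning

-- The alphabets

[suc] : ∀ n → [ suc n ] ≡ [ n ] ++ suc n ∷ []
[suc] n = trans (cong (map suc) (sym (upTo-∷ʳ n))) (map-++ suc (upTo n) (n ∷ []))

[suc]-↭ : ∀ n → [ suc n ] ↭ suc n ∷ [ n ]
[suc]-↭ n = ↭-trans (↭-reflexive ([suc] n)) (++-comm [ n ] (suc n ∷ []))

[suc]₂-↭ : ∀ n → [ suc n ]₂ ↭ suc n ∷ suc n ∷ [ n ]₂
[suc]₂-↭ n = ↭-trans
  (↭-reflexive (trans (cong (concatMap λ i → i ∷ i ∷ []) ([suc] n))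
                      (concatMap-++ (λ i → i ∷ i ∷ []) [ n ] (suc n ∷ []))))
  (++-comm [ n ]₂ (suc n ∷ suc n ∷ []))

[]-unique : ∀ n → Unique [ n ]
[]-unique n = Unique.map⁺ suc-injective (Unique.upTo⁺ n)

[]-bounded : ∀ n → All (_≤ n) [ n ]
[]-bounded zero    = []
[]-bounded (suc n) = All-resp-↭ (↭-sym ([suc]-↭ n))
  (≤-refl ∷ All.map m≤n⇒m≤1+n ([]-bounded n))

[]₂-bounded : ∀ n → All (_≤ n) [ n ]₂
[]₂-bounded zero    = []
[]₂-bounded (suc n) = All-resp-↭ (↭-sym ([suc]₂-↭ n))
  (≤-refl ∷ ≤-refl ∷ All.map m≤n⇒m≤1+n ([]₂-bounded n))

-- `suc n * 2` computes to `2 + n * 2`, which suits the later inductions that take two letters at a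
-- time.
[]₂-length : ∀ n → length [ n ]₂ ≡ n * 2
[]₂-length zero    = refl
[]₂-length (suc n) = trans (↭-length ([suc]₂-↭ n)) (cong (2 +_) ([]₂-length n))

[]₂⊆[] : ∀ n → All (_∈ [ n ]) [ n ]₂
[]₂⊆[] zero    = []
[]₂⊆[] (suc n) = All-resp-↭ (↭-sym ([suc]₂-↭ n))
  (new ∷ new ∷ All.map (λ k∈ → ∈-resp-↭ (↭-sym ([suc]-↭ n)) (there k∈)) ([]₂⊆[] n))
  where new = ∈-resp-↭ (↭-sym ([suc]-↭ n)) (here refl)

-- Stirling permutations

-- The Stirling condition as a condition on subsequences, so that insertion and erasure can be
-- treated by induction on `⊆` instead of by arithmetic of positions.
Nested : List ℕ → Set
Nested σ = ∀ {x y} → x ∷ y ∷ x ∷ [] ⊆ σ → x < y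

lookup-⊆₁ : (σ : List ℕ) (a : Fin (length σ)) → lookup σ a ∷ [] ⊆ σ
lookup-⊆₁ (x ∷ σ) Fin.zero    = refl ∷ minimum σ
lookup-⊆₁ (x ∷ σ) (Fin.suc a) = x ∷ʳ lookup-⊆₁ σ a

lookup-⊆₂ : (σ : List ℕ) (a b : Fin (length σ)) → a Fin.< b →
  lookup σ a ∷ lookup σ b ∷ [] ⊆ σ
lookup-⊆₂ (x ∷ σ) Fin.zero    (Fin.suc b) _   = refl ∷ lookup-⊆₁ σ b
lookup-⊆₂ (x ∷ σ) (Fin.suc a) (Fin.suc b) a<b = x ∷ʳ lookup-⊆₂ σ a b (s≤s⁻¹ a<b)

lookup-⊆₃ : (σ : List ℕ) (a b c : Fin (length σ)) → a Fin.< b → b Fin.< c →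
  lookup σ a ∷ lookup σ b ∷ lookup σ c ∷ [] ⊆ σ
lookup-⊆₃ (x ∷ σ) Fin.zero    (Fin.suc b) (Fin.suc c) _   b<c =
  refl ∷ lookup-⊆₂ σ b c (s≤s⁻¹ b<c)
lookup-⊆₃ (x ∷ σ) (Fin.suc a) (Fin.suc b) (Fin.suc c) a<b b<c =
  x ∷ʳ lookup-⊆₃ σ a b c (s≤s⁻¹ a<b) (s≤s⁻¹ b<c)

⊆-lookup₁ : ∀ {σ : List ℕ} {x} → x ∷ [] ⊆ σ → ∃ λ a → lookup σ a ≡ x
⊆-lookup₁ (refl ∷ p) = Fin.zero , refl
⊆-lookup₁ (_ ∷ʳ p)   = let a , eq = ⊆-lookup₁ p in Fin.suc a , eq

⊆-lookup₂ : ∀ {σ : List ℕ} {x y} → x ∷ y ∷ [] ⊆ σ →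
  ∃₂ λ a b → a Fin.< b × lookup σ a ≡ x × lookup σ b ≡ y
⊆-lookup₂ (refl ∷ p) =
  let b , eq = ⊆-lookup₁ p in Fin.zero , Fin.suc b , s≤s z≤n , refl , eq
⊆-lookup₂ (_ ∷ʳ p)   =
  let a , b , a<b , eqs = ⊆-lookup₂ p in Fin.suc a , Fin.suc b , s≤s a<b , eqs

⊆-lookup₃ : ∀ {σ : List ℕ} {x y z} → x ∷ y ∷ z ∷ [] ⊆ σ →
  ∃₂ λ a b → ∃ λ c → a Fin.< b × b Fin.< c ×
    lookup σ a ≡ x × lookup σ b ≡ y × lookup σ c ≡ z
⊆-lookup₃ (refl ∷ p) =
  let b , c , b<c , eqs = ⊆-lookup₂ p
  in Fin.zero , Fin.suc b , Fin.suc c , s≤s z≤n , s≤s b<c , refl , eqs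
⊆-lookup₃ (_ ∷ʳ p)   =
  let a , b , c , a<b , b<c , eqs = ⊆-lookup₃ p
  in Fin.suc a , Fin.suc b , Fin.suc c , s≤s a<b , s≤s b<c , eqs

isStirling⇒nested : ∀ n {σ} → IsStirling n σ → Nested σ
isStirling⇒nested n (_ , stirling) p =
  let a , b , c , a<b , b<c , eqᵃ , eqᵇ , eqᶜ = ⊆-lookup₃ p
  in subst₂ _<_ eqᵃ eqᵇ (stirling a b c a<b b<c (trans eqᵃ (sym eqᶜ)))

nested⇒isStirling : ∀ n {σ} → σ ↭ [ n ]₂ → Nested σ → IsStirling n σ
nested⇒isStirling n {σ} perm nested = perm , λ a b c a<b b<c eq →
  nested (subst (λ z → lookup σ a ∷ lookup σ b ∷ z ∷ [] ⊆ σ) (sym eq)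
                (lookup-⊆₃ σ a b c a<b b<c))

∈𝒬⁺ : ∀ n {σ} → σ ↭ [ n ]₂ → Nested σ → σ ∈ 𝒬 n
∈𝒬⁺ n {σ} perm nested = ∈-filter⁺ (isStirling? n)
  (subst (λ k → σ ∈ words [ n ] k) (trans (↭-length perm) (trans ([]₂-length n) (*-comm n 2)))
    (∈-words (All-resp-↭ (↭-sym perm) ([]₂⊆[] n))))
  (nested⇒isStirling n perm nested)

∈𝒬⁻ : ∀ n {σ} → σ ∈ 𝒬 n → σ ↭ [ n ]₂ × Nested σ
∈𝒬⁻ n σ∈ = let _ , stirling = ∈-filter⁻ (isStirling? n) {xs = words [ n ] (2 * n)} σ∈
             in proj₁ stirling , isStirling⇒nested n stirling

𝒬-unique : ∀ n → Unique (𝒬 n)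
𝒬-unique n = Unique.filter⁺ (isStirling? n) (words-unique ([]-unique n) (2 * n))

-- Insertion of two adjacent maximal letters

double : ℕ → List ℕ
double m = m ∷ m ∷ []

⊆-double⁻ : ∀ {m ws} us {vs} → All (_≢ m) ws →
  ws ⊆ us ++ double m ++ vs → ws ⊆ us ++ vs
⊆-double⁻ []       _        (_ ∷ʳ (_ ∷ʳ p))   = p
⊆-double⁻ []       (x≢m ∷ _) (refl ∷ _)        = contradiction refl x≢m
⊆-double⁻ []       (x≢m ∷ _) (_ ∷ʳ (refl ∷ _)) = contradiction refl x≢m
⊆-double⁻ (u ∷ us) ≢m       (_ ∷ʳ p)          = u ∷ʳ ⊆-double⁻ us ≢m p
⊆-double⁻ (u ∷ us) (_ ∷ ≢m) (refl ∷ p)        = refl ∷ ⊆-double⁻ us ≢m p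

-- The two copies of `m` in the block are the only ones and are adjacent, so no letter fits between
-- them.
¬sandwich : ∀ {m y} us {vs} → All (_< m) (us ++ vs) →
  ¬ (m ∷ y ∷ m ∷ [] ⊆ us ++ double m ++ vs)
¬sandwich []       <m (refl ∷ (refl ∷ p))        = <-irrefl refl (All.lookup <m (to∈ p))
¬sandwich []       <m (refl ∷ (_ ∷ʳ p))          =
  <-irrefl refl (All.lookup <m (to∈ (⊆-trans (_ ∷ʳ ⊆-refl) p)))
¬sandwich []       <m (_ ∷ʳ (refl ∷ p))          =
  <-irrefl refl (All.lookup <m (to∈ (⊆-trans (_ ∷ʳ ⊆-refl) p)))
¬sandwich []       <m (_ ∷ʳ (_ ∷ʳ p))            = <-irrefl refl (All.lookup <m (to∈ p))
¬sandwich (u ∷ us) (_ ∷ <m) (_ ∷ʳ p)             = ¬sandwich us <m p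
¬sandwich (u ∷ us) (m<m ∷ _) (refl ∷ _)          = <-irrefl refl m<m

-- In a pattern `x y x` the outer letter cannot be `m`. If the inner one is `m`, then `x` is an old
-- letter and hence smaller; otherwise the pattern already occurs in the old word.
nested-double⁺ : ∀ {m} us {vs} → All (_< m) (us ++ vs) →
  Nested (us ++ vs) → Nested (us ++ double m ++ vs)
nested-double⁺ {m} us <m nested {x} {y} p with x ≟ m | y ≟ m
... | yes refl | _        = ⊥-elim (¬sandwich us <m p)
... | no x≢m   | no y≢m   = nested (⊆-double⁻ us (x≢m ∷ y≢m ∷ x≢m ∷ []) p)
... | no x≢m   | yes refl =
  All.lookup <m (to∈ (⊆-double⁻ us (x≢m ∷ []) (⊆-trans (refl ∷ minimum _) p)))

nested-⊆ : ∀ {σ τ} → σ ⊆ τ → Nested τ → Nested σ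
nested-⊆ σ⊆τ nested p = nested (⊆-trans p σ⊆τ)

++-⊆ : ∀ (us b : List A) {vs} → us ++ vs ⊆ us ++ b ++ vs
++-⊆ us b = Sublist.++⁺ (⊆-refl {x = us}) (Sublist.++⁺ˡ b ⊆-refl)

-- Whatever stands between two maximal entries would have to exceed them.
nested⇒adjacent : ∀ {m} us ys {vs} → All (_≤ m) (us ++ m ∷ ys ++ m ∷ vs) →
  Nested (us ++ m ∷ ys ++ m ∷ vs) → ys ≡ []
nested⇒adjacent us []       ≤m nested = refl
nested⇒adjacent {m} us (y ∷ ys) {vs} ≤m nested = contradiction
  (All.lookup ≤m (∈-++⁺ʳ us (there (here refl))))
  (<⇒≱ (nested (Sublist.++⁺ˡ us (refl ∷ refl ∷ from∈ (∈-insert ys)))))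

-- One copy of `m` is located first; the other lies to its right or to its left, and nestedness
-- leaves nothing between the two.
split-double : ∀ {m τ σ} → τ ↭ m ∷ m ∷ σ → All (_≤ m) τ → Nested τ →
  ∃₂ λ us vs → τ ≡ us ++ double m ++ vs
split-double {m} {τ} {σ} perm ≤m nested with ∈-∃++ (∈-resp-↭ (↭-sym perm) (here refl))
... | us , vs , refl
  with ∈-++⁻ us (∈-resp-↭ (↭-sym (drop-∷ (↭-trans (↭-sym (shift m us vs)) perm))) (here refl))
...   | inj₂ m∈vs with ∈-∃++ m∈vs
...     | ys , zs , refl with nested⇒adjacent us ys ≤m nested
...       | refl = us , zs , refl
split-double {m} {τ} {σ} perm ≤m nested | us , vs , refl | inj₁ m∈us with ∈-∃++ m∈us
...     | ws , ys , refl
  with nested⇒adjacent ws ys (subst (All (_≤ m)) (++-assoc ws (m ∷ ys) (m ∷ vs)) ≤m)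
         (subst Nested (++-assoc ws (m ∷ ys) (m ∷ vs)) nested)
...       | refl = ws , vs , ++-assoc ws (m ∷ []) (m ∷ vs)

-- The recursion for Stirling permutations

erase : ℕ → List ℕ → List ℕ
erase m = filter λ k → ¬? (k ≟ m)

𝒬-bounded : ∀ n {σ} → σ ∈ 𝒬 n → All (_< suc n) σ
𝒬-bounded n σ∈ = All-resp-↭ (↭-sym (proj₁ (∈𝒬⁻ n σ∈))) (All.map s≤s ([]₂-bounded n))

erase-insertion : ∀ {m σ τ} → All (_< m) σ → τ ∈ insertions (double m) σ → erase m τ ≡ σ
erase-insertion {m} <m τ∈ with ∈-insertions⁻ (double m) τ∈
... | us , vs , refl , refl =
  filter-block (λ k → ¬? (k ≟ m)) us (All.map <⇒≢ <m) (contradiction refl ∷ contradiction refl ∷ [])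

𝒬-suc : ∀ n → 𝒬 (suc n) ↭ concatMap (insertions (double (suc n))) (𝒬 n)
𝒬-suc n = ↭-concatMap (insertions (double m)) (erase m) (𝒬-unique n) (𝒬-unique m)
  (λ σ∈ → insertions-unique λ m∈ → <-irrefl refl (All.lookup (𝒬-bounded n σ∈) m∈))
  (λ σ∈ → erase-insertion (𝒬-bounded n σ∈))
  sound complete
  where
  m = suc n

  perm : ∀ us {vs} → us ++ double m ++ vs ↭ double m ++ us ++ vs
  perm us = shifts us (double m)

  sound : ∀ {σ τ} → σ ∈ 𝒬 n → τ ∈ insertions (double m) σ → τ ∈ 𝒬 m
  sound σ∈ τ∈ with ∈-insertions⁻ (double m) τ∈
  ... | us , vs , refl , refl = ∈𝒬⁺ m
    (↭-trans (perm us) (↭-trans (prep m (prep m (proj₁ (∈𝒬⁻ n σ∈)))) (↭-sym ([suc]₂-↭ n))))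
    (nested-double⁺ us (𝒬-bounded n σ∈) (proj₂ (∈𝒬⁻ n σ∈)))

  complete : ∀ {τ} → τ ∈ 𝒬 m → ∃ λ σ → σ ∈ 𝒬 n × τ ∈ insertions (double m) σ
  complete τ∈ with ∈𝒬⁻ m τ∈
  ... | perm-τ , nested
    with split-double (↭-trans perm-τ ([suc]₂-↭ n)) (All-resp-↭ (↭-sym perm-τ) ([]₂-bounded m)) nested
  ... | us , vs , refl = us ++ vs
    , ∈𝒬⁺ n (drop-∷ (drop-∷ (↭-trans (↭-sym (perm us)) (↭-trans perm-τ ([suc]₂-↭ n)))))
          (nested-⊆ (++-⊆ us (double m)) nested)
    , ∈-insertions⁺ us (double m) vs

-- Marked permutations

-- P a says that a is smaller than every entry preceding the word.
AdmissibleAfter : (ℕ → Set) → MarkedWord → Set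
AdmissibleAfter P []            = ⊤
AdmissibleAfter P ((a , b) ∷ π) =
  (T b → ¬ P a) × AdmissibleAfter (λ c → P c × c < a) π

-- Passing to the tail moves the comparison with the first entry out of the minimum condition and
-- into the predicate, which is why the induction needs an arbitrary `P`.
admissible⁺ : ∀ {P} π →
  (∀ i → Marked π i → P (entry π i) → ¬ IsLeftToRightMinimum π i) → AdmissibleAfter P π
admissible⁺ []      _  = tt
admissible⁺ (a ∷ π) ok =
  (λ marked pa → ok Fin.zero marked pa λ _ ()) ,
  admissible⁺ π λ i marked (pi , i<a) min → ok (Fin.suc i) marked pi λ where
    Fin.zero    _   → i<a
    (Fin.suc j) j<i → min j (s≤s⁻¹ j<i)

admissible⁻ : ∀ {P} π → AdmissibleAfter P π →
  ∀ i → Marked π i → P (entry π i) → ¬ IsLeftToRightMinimum π i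
admissible⁻ (a ∷ π) (ok , _) Fin.zero    marked pa _   = ok marked pa
admissible⁻ (a ∷ π) (_ , ok) (Fin.suc i) marked pi min =
  admissible⁻ π ok i marked (pi , min Fin.zero (s≤s z≤n)) λ j j<i → min (Fin.suc j) (s≤s j<i)

-- A stronger predicate forbids fewer marks. The implication is asked only at the entries of `π`,
-- because on erasing a maximal `m` the bound `c < m` is known only for those.
admissible-mono : ∀ {P Q} π → All (λ a → Q (proj₁ a) → P (proj₁ a)) π →
  AdmissibleAfter P π → AdmissibleAfter Q π
admissible-mono []      _          _         = tt
admissible-mono (a ∷ π) (q⇒p ∷ Q⇒P) (ok , oks) =
  (λ marked → ok marked ∘ q⇒p) ,
  admissible-mono π (All.map (λ q⇒p (q , <a) → q⇒p q , <a) Q⇒P) oks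

-- A new entry only adds a comparison for the entries behind it, so the old marks stay allowed and
-- just the mark on `m` has to be justified.
admissible-insert : ∀ {P m b} us {vs} → All ((_< m) ∘ proj₁) (us ++ vs) → (T b → ¬ P m) →
  AdmissibleAfter P (us ++ vs) → AdmissibleAfter P (us ++ (m , b) ∷ vs)
admissible-insert []       {vs} <m       ok oks        =
  ok , admissible-mono vs (All.universal (λ _ → proj₁) vs) oks
admissible-insert (u ∷ us)      (_ ∷ <m) ok (okᵘ , oks) =
  okᵘ , admissible-insert us <m (λ marked → ok marked ∘ proj₁) oks

-- The preceding entry `u` is below `m`, so `m` is not a left-to-right minimum and either flag is
-- allowed.
admissible-insert-later : ∀ {P m b} u us {vs} → All ((_< m) ∘ proj₁) (u ∷ us ++ vs) →
  AdmissibleAfter P (u ∷ us ++ vs) → AdmissibleAfter P (u ∷ us ++ (m , b) ∷ vs)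
admissible-insert-later u us (u<m ∷ <m) (okᵘ , oks) =
  okᵘ , admissible-insert us <m (λ _ (_ , m<u) → <-asym u<m m<u) oks

-- A larger entry in front never stops a smaller one from being a left-to-right minimum, so erasing
-- `m` creates no new minima.
admissible-erase : ∀ {P m b} us {vs} → All ((_< m) ∘ proj₁) (us ++ vs) →
  AdmissibleAfter P (us ++ (m , b) ∷ vs) → AdmissibleAfter P (us ++ vs)
admissible-erase []       {vs} <m       (_ , oks)   =
  admissible-mono vs (All.map (λ c<m p → p , c<m) <m) oks
admissible-erase (u ∷ us)      (_ ∷ <m) (okᵘ , oks) = okᵘ , admissible-erase us <m oks

Admissible : MarkedWord → Set
Admissible = AdmissibleAfter λ _ → ⊤

marks : List Bool
marks = false ∷ true ∷ []

∈-marks : ∀ b → b ∈ marks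
∈-marks false = here refl
∈-marks true  = there (here refl)

∈𝔖̄⁺ : ∀ n {π} → map proj₁ π ↭ [ n ] → Admissible π → π ∈ 𝔖̄ n
∈𝔖̄⁺ n {π} perm ok = ∈-filter⁺ (isMarkedPermutation? n)
  (subst (λ k → π ∈ words (cartesianProduct [ n ] marks) k) length-π (∈-words letters))
  (perm , λ i marked → admissible⁻ π ok i marked tt)
  where
  length-π : length π ≡ n
  length-π = trans (sym (length-map proj₁ π))
    (trans (↭-length perm) (trans (length-map suc (upTo n)) (length-upTo n)))

  letters : All (_∈ cartesianProduct [ n ] marks) π
  letters = All.map (λ a∈ → ∈-cartesianProduct⁺ a∈ (∈-marks _))
    (All.map⁻ (All-resp-↭ (↭-sym perm) (All.tabulate id)))

∈𝔖̄⁻ : ∀ n {π} → π ∈ 𝔖̄ n → map proj₁ π ↭ [ n ] × Admissible π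
∈𝔖̄⁻ n {π} π∈ =
  let _ , perm , ok = ∈-filter⁻ (isMarkedPermutation? n)
                        {xs = words (cartesianProduct [ n ] marks) n} π∈
  in perm , admissible⁺ π λ i marked _ → ok i marked

𝔖̄-unique : ∀ n → Unique (𝔖̄ n)
𝔖̄-unique n = Unique.filter⁺ (isMarkedPermutation? n)
  (words-unique (Unique.cartesianProduct⁺ ([]-unique n) (((λ ()) ∷ []) ∷ [] ∷ [])) n)

[]<suc : ∀ n {π : MarkedWord} → map proj₁ π ↭ [ n ] → All ((_< suc n) ∘ proj₁) π
[]<suc n perm = All.map⁻ (All-resp-↭ (↭-sym perm) (All.map s≤s ([]-bounded n)))

𝔖̄-bounded : ∀ n {π} → π ∈ 𝔖̄ n → All ((_< suc n) ∘ proj₁) π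
𝔖̄-bounded n π∈ = []<suc n (proj₁ (∈𝔖̄⁻ n π∈))

-- The recursion for marked permutations

eraseEntry : ℕ → MarkedWord → MarkedWord
eraseEntry m = filter λ a → ¬? (proj₁ a ≟ m)

single : ℕ → Bool → MarkedWord
single m b = (m , b) ∷ []

-- A maximal entry put first is a left-to-right minimum; put later, it is not.
markedInsertions : ℕ → MarkedWord → List MarkedWord
markedInsertions m π = insertions (single m false) π ++ laterInsertions (single m true) π

markedInsertions⁻ : ∀ m {π ρ} → ρ ∈ markedInsertions m π →
  ∃₂ λ us vs → ∃ λ b → π ≡ us ++ vs × ρ ≡ us ++ (m , b) ∷ vs
markedInsertions⁻ m {π} ρ∈ with ∈-++⁻ (insertions (single m false) π) ρ∈
... | inj₁ ρ∈′ = let us , vs , eq , eq′ = ∈-insertions⁻ (single m false) ρ∈′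
                in us , vs , false , eq , eq′
... | inj₂ ρ∈′ = let us , vs , eq , eq′ = ∈-insertions⁻ (single m true) (there ρ∈′)
                in us , vs , true , eq , eq′

markedInsertions-admissible : ∀ {m π ρ} → All ((_< m) ∘ proj₁) π → Admissible π →
  ρ ∈ markedInsertions m π → Admissible ρ
markedInsertions-admissible {m} {π} <m ok ρ∈ with ∈-++⁻ (insertions (single m false) π) ρ∈
... | inj₁ ρ∈′ with ∈-insertions⁻ (single m false) ρ∈′
...   | us , vs , refl , refl = admissible-insert us <m (λ ()) ok
markedInsertions-admissible {m} {π} <m ok ρ∈ | inj₂ ρ∈′
  with ∈-laterInsertions⁻ (single m true) {π} ρ∈′
...   | u , us , vs , refl , refl = admissible-insert-later u us <m ok

markedInsertions-unique : ∀ {m π} → All ((_< m) ∘ proj₁) π → Unique (markedInsertions m π)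
markedInsertions-unique {m} {π} <m = Unique.++⁺
  -- The later insertions are all insertions with the first one dropped.
  (insertions-unique (new false)) (Unique.drop⁺ 1 (insertions-unique (new true)))
  λ { (ρ∈ , ρ∈′) → disjoint ρ∈ ρ∈′ }
  where
  new : ∀ b → (m , b) ∉ π
  new b ∈π = <-irrefl refl (All.lookup <m ∈π)

  -- The letter `(m , true)` tells the two lists apart: it occurs in every word of the second and in
  -- none of the first.
  disjoint : ∀ {ρ} → ρ ∈ insertions (single m false) π → ¬ ρ ∈ laterInsertions (single m true) π
  disjoint ρ∈ ρ∈′ with ∈-insertions⁻ (single m false) ρ∈ | ∈-insertions⁻ (single m true) {π} (there ρ∈′)
  ... | us , vs , eq , refl | us′ , vs′ , refl , eq′
    with ∈-++⁻ us (subst ((m , true) ∈_) (sym eq′) (∈-insert us′))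
  ...   | inj₁ ∈us         = new true (subst ((m , true) ∈_) (sym eq) (∈-++⁺ˡ ∈us))
  ...   | inj₂ (there ∈vs) = new true (subst ((m , true) ∈_) (sym eq) (∈-++⁺ʳ us ∈vs))

𝔖̄-suc : ∀ n → 𝔖̄ (suc n) ↭ concatMap (markedInsertions (suc n)) (𝔖̄ n)
𝔖̄-suc n = ↭-concatMap (markedInsertions m) (eraseEntry m) (𝔖̄-unique n) (𝔖̄-unique m)
  (λ π∈ → markedInsertions-unique (𝔖̄-bounded n π∈)) erased sound complete
  where
  m = suc n

  erased : ∀ {π ρ} → π ∈ 𝔖̄ n → ρ ∈ markedInsertions m π → eraseEntry m ρ ≡ π
  erased π∈ ρ∈ with markedInsertions⁻ m ρ∈
  ... | us , vs , b , refl , refl = filter-block (λ a → ¬? (proj₁ a ≟ m)) us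
    (All.map <⇒≢ (𝔖̄-bounded n π∈)) (contradiction refl ∷ [])

  perm : ∀ us {vs b} → map proj₁ (us ++ (m , b) ∷ vs) ↭ m ∷ map proj₁ (us ++ vs)
  perm us {vs} {b} = ↭.map⁺ proj₁ (shift (m , b) us vs)

  sound : ∀ {π ρ} → π ∈ 𝔖̄ n → ρ ∈ markedInsertions m π → ρ ∈ 𝔖̄ m
  sound {π} {ρ} π∈ ρ∈ = ∈𝔖̄⁺ m perm-ρ
    (markedInsertions-admissible (𝔖̄-bounded n π∈) (proj₂ (∈𝔖̄⁻ n π∈)) ρ∈)
    where
    perm-ρ : map proj₁ ρ ↭ [ m ]
    perm-ρ with markedInsertions⁻ m ρ∈
    ... | us , vs , b , refl , refl =
      ↭-trans (perm us) (↭-trans (prep m (proj₁ (∈𝔖̄⁻ n π∈))) (↭-sym ([suc]-↭ n)))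

  occurs : ∀ {us vs} b → Admissible (us ++ (m , b) ∷ vs) →
    us ++ (m , b) ∷ vs ∈ markedInsertions m (us ++ vs)
  occurs {us}     {vs} false _        = ∈-++⁺ˡ (∈-insertions⁺ us (single m false) vs)
  -- The first entry is vacuously a left-to-right minimum, so it cannot carry a mark.
  occurs {[]}          true  (ok , _) = contradiction tt (ok tt)
  occurs {u ∷ us} {vs} true  _        = ∈-++⁺ʳ (insertions (single m false) (u ∷ us ++ vs))
    (∈-map⁺ (u ∷_) (∈-insertions⁺ us (single m true) vs))

  complete : ∀ {ρ} → ρ ∈ 𝔖̄ m → ∃ λ π → π ∈ 𝔖̄ n × ρ ∈ markedInsertions m π
  complete ρ∈ with ∈𝔖̄⁻ m ρ∈
  ... | perm-ρ , ok
    with ∈-map⁻ proj₁ (∈-resp-↭ (↭-sym (↭-trans perm-ρ ([suc]-↭ n))) (here refl))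
  ... | (_ , b) , a∈ , refl with ∈-∃++ a∈
  ... | us , vs , refl = us ++ vs , ∈𝔖̄⁺ n perm-π (admissible-erase us ([]<suc n perm-π) ok)
                       , occurs b ok
    where
    perm-π = drop-∷ (↭-trans (↭-sym (perm us {vs} {b})) (↭-trans perm-ρ ([suc]-↭ n)))

-- Ascent plateaus and parities of positions

-- The contribution of one consecutive triple, shaped so that `ap (x ∷ y ∷ z ∷ σ)` computes to
-- `plateau x y z + ap (y ∷ z ∷ σ)`.
plateau : ℕ → ℕ → ℕ → ℕ
plateau x y z = if does ((x <? y) ×-dec (y ≟ z)) then 1 else 0

plateau-descent : ∀ {x y} z → ¬ x < y → plateau x y z ≡ 0
plateau-descent {x} {y} z x≮y =
  cong (if_then 1 else 0) (dec-false ((x <? y) ×-dec (y ≟ z)) (x≮y ∘ proj₁))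

plateau-≢ : ∀ x {y z} → y ≢ z → plateau x y z ≡ 0
plateau-≢ x {y} {z} y≢z =
  cong (if_then 1 else 0) (dec-false ((x <? y) ×-dec (y ≟ z)) (y≢z ∘ proj₂))

plateau-ascent : ∀ {x y} → x < y → plateau x y y ≡ 1
plateau-ascent {x} {y} x<y =
  cong (if_then 1 else 0) (dec-true ((x <? y) ×-dec (y ≟ y)) (x<y , refl))

plateau-cases : ∀ x y z → (x < y × y ≡ z) ⊎ plateau x y z ≡ 0
plateau-cases x y z with (x <? y) ×-dec (y ≟ z)
... | yes asc = inj₁ asc
... | no ¬asc = inj₂ (cong (if_then 1 else 0) (dec-false ((x <? y) ×-dec (y ≟ z)) ¬asc))

ap-descent : ∀ {x y} σ → ¬ x < y → ap (x ∷ y ∷ σ) ≡ ap (y ∷ σ)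
ap-descent []      x≮y = refl
ap-descent {y = y} (z ∷ σ) x≮y = cong (_+ ap (y ∷ z ∷ σ)) (plateau-descent z x≮y)

-- Neither the step from `m` to `m` nor the step down from `m` is an ascent.
ap-double : ∀ {m σ} → All (_< m) σ → ap (double m ++ σ) ≡ ap σ
ap-double []                = refl
ap-double {m} (_∷_ {x} {σ} x<m _) =
  trans (ap-descent {m} (x ∷ σ) (<-irrefl refl)) (ap-descent σ (<-asym x<m))

ap-∷-double : ∀ {m x σ} → x < m → All (_< m) σ → ap (x ∷ double m ++ σ) ≡ suc (ap σ)
ap-∷-double x<m σ<m = cong₂ _+_ (plateau-ascent x<m) (ap-double σ<m)

-- The block separates `y` from `σ`: besides the new plateau at `m`, only those counted within `σ`
-- remain.
ap-∷∷-double : ∀ {m x y σ} → y < m → All (_< m) σ →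
  ap (x ∷ y ∷ double m ++ σ) ≡ suc (ap σ)
ap-∷∷-double {x = x} y<m σ<m = cong₂ _+_ (plateau-≢ x (<⇒≢ y<m)) (ap-∷-double y<m σ<m)

firstPosition-here : ∀ m σ → firstPosition m (m ∷ σ) ≡ 1
firstPosition-here m σ =
  cong (if_then 1 else suc (firstPosition m σ)) (dec-true (m ≟ m) refl)

firstPosition-there : ∀ {x m} σ → x ≢ m → firstPosition m (x ∷ σ) ≡ suc (firstPosition m σ)
firstPosition-there {x} {m} σ x≢m =
  cong (if_then 1 else suc (firstPosition m σ)) (dec-false (x ≟ m) x≢m)

-- The first position is unchanged if `k` occurs in `us` and moves by two otherwise; this includes
-- an absent `k`, whose default value lies one past the end.
firstPosition-double : ∀ {k m} us {vs} → m ≢ k →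
  firstPosition k (us ++ double m ++ vs) ≡ firstPosition k (us ++ vs) ⊎
  firstPosition k (us ++ double m ++ vs) ≡ 2 + firstPosition k (us ++ vs)
firstPosition-double {k} {m} [] {vs} m≢k = inj₂
  (trans (firstPosition-there (m ∷ vs) m≢k) (cong suc (firstPosition-there vs m≢k)))
firstPosition-double {k} {m} (u ∷ us) m≢k with does (u ≟ k) | firstPosition-double {k} {m} us m≢k
... | true  | _       = inj₁ refl
... | false | inj₁ eq = inj₁ (cong suc eq)
... | false | inj₂ eq = inj₂ (cong suc eq)

2∣-2+ : ∀ p → does (2 ∣? (2 + p)) ≡ does (2 ∣? p)
2∣-2+ p = does-⇔ (mk⇔ (λ 2∣2+p → ∣m+n∣m⇒∣n 2∣2+p ∣-refl) (∣m∣n⇒∣m+n ∣-refl)) (2 ∣? (2 + p)) (2 ∣? p)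

evenIndexed-double : ∀ {k m} us {vs} → m ≢ k →
  does (evenIndexed? (us ++ double m ++ vs) k) ≡ does (evenIndexed? (us ++ vs) k)
evenIndexed-double {k} {m} us {vs} m≢k with firstPosition-double {k} {m} us {vs} m≢k
... | inj₁ eq = cong (λ p → does (2 ∣? p)) eq
... | inj₂ eq = trans (cong (λ p → does (2 ∣? p)) eq) (2∣-2+ (firstPosition k (us ++ vs)))

filter-cong-does : {P Q : Pred A 0ℓ} (P? : Decidable P) (Q? : Decidable Q) {xs : List A} →
  All (λ x → does (P? x) ≡ does (Q? x)) xs → filter P? xs ≡ filter Q? xs
filter-cong-does P? Q? []                  = refl
filter-cong-does P? Q? (_∷_ {x} eq eqs) with does (P? x) | does (Q? x) | eq
... | true  | _ | refl = cong (x ∷_) (filter-cong-does P? Q? eqs)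
... | false | _ | refl = filter-cong-does P? Q? eqs

bit : Bool → ℕ
bit b = if b then 1 else 0

even-double : ∀ n us {vs} → let τ = us ++ double (suc n) ++ vs in
  even (suc n) τ ≡ even n (us ++ vs) + bit (does (evenIndexed? τ (suc n)))
even-double n us {vs} = begin
  length (filter τ? [ suc n ])                      ≡⟨ cong (length ∘ filter τ?) ([suc] n) ⟩
  length (filter τ? ([ n ] ++ suc n ∷ []))          ≡⟨ cong length (filter-++ τ? [ n ] (suc n ∷ [])) ⟩
  length (filter τ? [ n ] ++ filter τ? (suc n ∷ [])) ≡⟨ length-++ (filter τ? [ n ]) ⟩
  length (filter τ? [ n ]) + length (filter τ? (suc n ∷ []))
    ≡⟨ cong₂ (λ ks k → length ks + k) (filter-cong-does τ? σ? agree) last ⟩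
  length (filter σ? [ n ]) + bit (does (τ? (suc n))) ∎
  where
  open ≡-Reasoning
  τ? = evenIndexed? (us ++ double (suc n) ++ vs)
  σ? = evenIndexed? (us ++ vs)

  agree : All (λ k → does (τ? k) ≡ does (σ? k)) [ n ]
  agree = All.map (λ k≤n → evenIndexed-double us (<⇒≢ (s≤s k≤n) ∘ sym)) ([]-bounded n)

  last : length (filter τ? (suc n ∷ [])) ≡ bit (does (τ? (suc n)))
  last with does (τ? (suc n))
  ... | true  = refl
  ... | false = refl

mark-true : ∀ m us {vs} → mark (us ++ (m , true) ∷ vs) ≡ suc (mark (us ++ (m , false) ∷ vs))
mark-true m []                 = refl
mark-true m ((_ , true) ∷ us)  = cong suc (mark-true m us)
mark-true m ((_ , false) ∷ us) = mark-true m us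

asc-true : ∀ m us {vs} → asc (us ++ (m , true) ∷ vs) ≡ asc (us ++ (m , false) ∷ vs)
asc-true m us {vs} = cong ascents
  (trans (map-++ proj₁ us ((m , true) ∷ vs)) (sym (map-++ proj₁ us ((m , false) ∷ vs))))

asc-∷-bounded : ∀ {m b π} → All ((_< m) ∘ proj₁) π → asc ((m , b) ∷ π) ≡ asc π
asc-∷-bounded []                                  = refl
asc-∷-bounded {m} (_∷_ {x = a} {xs = π} a<m _) =
  cong (λ b → bit b + asc (a ∷ π)) (dec-false (m <? proj₁ a) (<-asym a<m))

-- The two sums

module Sums {c ℓ} (R : CommutativeRing c ℓ) (X : CommutativeRing.Carrier R) where

  open RingNotation R
  private module R = CommutativeRing R
  open import Algebra.Properties.Ring R.ring
    using (-1*x≈-x; -‿distribʳ-*; -‿involutive; -‿+-comm; -0#≈0#)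
  open import Algebra.Properties.CommutativeSemigroup R.+-commutativeSemigroup
    using () renaming (x∙yz≈y∙xz to x+yz≈y+xz)
  open import Algebra.Properties.CommutativeSemigroup R.*-commutativeSemigroup
    using (x∙yz≈y∙xz)
  open import Algebra.Properties.Semiring.Exp R.semiring using (^-homo-*; ^-congʳ)
  open import Relation.Binary.Reasoning.Setoid R.setoid

  -- Finite sums and signs in a commutative ring

  ∑-cong : (xs : List A) {f g : A → Carrier} → (∀ {a} → a ∈ xs → f a ≈ g a) → ∑ xs f ≈ ∑ xs g
  ∑-cong []       f≈g = R.refl
  ∑-cong (x ∷ xs) f≈g = R.+-cong (f≈g (here refl)) (∑-cong xs (f≈g ∘ there))

  ∑-map : (h : A → B) (xs : List A) (f : B → Carrier) → ∑ (map h xs) f ≈ ∑ xs (f ∘ h)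
  ∑-map h []       f = R.refl
  ∑-map h (x ∷ xs) f = R.+-congˡ (∑-map h xs f)

  ∑-++ : (xs ys : List A) (f : A → Carrier) → ∑ (xs ++ ys) f ≈ ∑ xs f +ᴿ ∑ ys f
  ∑-++ []       ys f = R.sym (R.+-identityˡ _)
  ∑-++ (x ∷ xs) ys f = R.trans (R.+-congˡ (∑-++ xs ys f)) (R.sym (R.+-assoc _ _ _))

  ∑-concatMap : (h : A → List B) (xs : List A) (f : B → Carrier) →
    ∑ (concatMap h xs) f ≈ ∑ xs (λ a → ∑ (h a) f)
  ∑-concatMap h []       f = R.refl
  ∑-concatMap h (x ∷ xs) f =
    R.trans (∑-++ (h x) (concatMap h xs) f) (R.+-congˡ (∑-concatMap h xs f))

  ∑-↭ : {xs ys : List A} (f : A → Carrier) → xs ↭ ys → ∑ xs f ≈ ∑ ys f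
  ∑-↭ f _↭_.refl           = R.refl
  ∑-↭ f (_↭_.prep x p)     = R.+-congˡ (∑-↭ f p)
  ∑-↭ f (_↭_.swap x y p)   = R.trans (x+yz≈y+xz _ _ _) (R.+-congˡ (R.+-congˡ (∑-↭ f p)))
  ∑-↭ f (_↭_.trans p q)    = R.trans (∑-↭ f p) (∑-↭ f q)

  ∑-scale : ∀ r (xs : List A) (f : A → Carrier) → ∑ xs (λ a → r · f a) ≈ r · ∑ xs f
  ∑-scale r []       f = R.sym (R.zeroʳ r)
  ∑-scale r (x ∷ xs) f = R.trans (R.+-congˡ (∑-scale r xs f)) (R.sym (R.distribˡ r _ _))

  ∑-neg : (xs : List A) (f : A → Carrier) → ∑ xs (λ a → - f a) ≈ - ∑ xs f
  ∑-neg []       f = R.sym -0#≈0#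
  ∑-neg (x ∷ xs) f = R.trans (R.+-congˡ (∑-neg xs f)) (-‿+-comm _ _)

  sign-suc-suc : ∀ k → (- 1#) ^ (2 + k) ≈ (- 1#) ^ k
  sign-suc-suc k = begin
    - 1# · (- 1# · (- 1#) ^ k)  ≈⟨ -1*x≈-x _ ⟩
    - (- 1# · (- 1#) ^ k)       ≈⟨ R.-‿cong (-1*x≈-x _) ⟩
    - (- (- 1#) ^ k)            ≈⟨ -‿involutive _ ⟩
    (- 1#) ^ k                  ∎

  -- Position `p` contributes a factor `- 1#` exactly when it is even, that is, when `suc p` is odd.
  sign-even : ∀ p → (- 1#) ^ bit (does (2 ∣? p)) ≈ (- 1#) ^ suc p
  sign-even zero          = R.refl
  sign-even (suc zero)    = R.sym (sign-suc-suc 0)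
  sign-even (suc (suc p)) = begin
    (- 1#) ^ bit (does (2 ∣? (2 + p)))  ≈⟨ ^-congʳ (- 1#) (cong bit (2∣-2+ p)) ⟩
    (- 1#) ^ bit (does (2 ∣? p))        ≈⟨ sign-even p ⟩
    (- 1#) ^ suc p                      ≈⟨ sign-suc-suc (suc p) ⟨
    (- 1#) ^ (3 + p)                    ∎

  -- The alternating sum over the gaps of a word

  module _ (m : ℕ) where

    sign : List ℕ → Carrier
    sign τ = (- 1#) ^ suc (firstPosition m τ)

    sign-here : ∀ τ → sign (m ∷ τ) ≈ 1#
    sign-here τ = R.trans (^-congʳ (- 1#) (cong suc (firstPosition-here m τ))) (sign-suc-suc 0)

    sign-there : ∀ {x} τ → x ≢ m → sign (x ∷ τ) ≈ - sign τ
    sign-there τ x≢m =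
      R.trans (^-congʳ (- 1#) (cong suc (firstPosition-there τ x≢m))) (-1*x≈-x _)

    -- The function `f` is arbitrary so that a letter `x` split off in front can be absorbed into
    -- `f ∘ (x ∷_)`.
    alternatingSum : List ℕ → (List ℕ → Carrier) → Carrier
    alternatingSum σ f = ∑[ τ ∈ insertions (double m) σ ] (f τ · sign τ)

    alternatingSum-[] : ∀ f → alternatingSum [] f ≈ f (double m)
    alternatingSum-[] f = begin
      f (double m) · sign (double m) +ᴿ 0#  ≈⟨ R.+-identityʳ _ ⟩
      f (double m) · sign (double m)        ≈⟨ R.*-congˡ (sign-here (m ∷ [])) ⟩
      f (double m) · 1#                     ≈⟨ R.*-identityʳ _ ⟩
      f (double m)                          ∎

    -- Every gap except the first lies behind `x`, which shifts the position of `m` by one and so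
    -- flips the sign.
    alternatingSum-∷ : ∀ {x} σ f → x < m →
      alternatingSum (x ∷ σ) f ≈ f (double m ++ x ∷ σ) +ᴿ - alternatingSum σ (f ∘ (x ∷_))
    alternatingSum-∷ {x} σ f x<m = R.+-cong
      (R.trans (R.*-congˡ (sign-here (m ∷ x ∷ σ))) (R.*-identityʳ _))
      (begin
        ∑ (map (x ∷_) τs) (λ τ → f τ · sign τ)      ≈⟨ ∑-map (x ∷_) τs _ ⟩
        ∑[ τ ∈ τs ] (f (x ∷ τ) · sign (x ∷ τ))      ≈⟨ ∑-cong τs (λ {τ} _ → R.*-congˡ (sign-there τ (<⇒≢ x<m))) ⟩
        ∑[ τ ∈ τs ] (f (x ∷ τ) · - sign τ)          ≈⟨ ∑-cong τs (λ _ → R.sym (-‿distribʳ-* _ _)) ⟩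
        ∑[ τ ∈ τs ] (- (f (x ∷ τ) · sign τ))        ≈⟨ ∑-neg τs _ ⟩
        - alternatingSum σ (f ∘ (x ∷_))             ∎)
      where τs = insertions (double m) σ

    -- Two letters of context suffice: a block put directly behind `y` affects the triples starting
    -- at `x` and at `y`, but none starting earlier.
    tailSum : ℕ → ℕ → List ℕ → Carrier
    tailSum x y σ = alternatingSum σ λ τ → X ^ ap (x ∷ y ∷ τ)

    -- The gap before `z` breaks the triples starting at `x` and `y`. All later gaps keep the triple
    -- `x y z`, whose factor can be pulled out.
    tailSum-∷ : ∀ x {y z σ} → y < m → z < m → All (_< m) σ →
      tailSum x y (z ∷ σ) ≈ X ^ suc (ap (z ∷ σ)) +ᴿ - (X ^ plateau x y z · tailSum y z σ)
    tailSum-∷ x {y} {z} {σ} y<m z<m σ<m = begin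
      tailSum x y (z ∷ σ)
        ≈⟨ alternatingSum-∷ σ _ z<m ⟩
      X ^ ap (x ∷ y ∷ double m ++ z ∷ σ) +ᴿ
        - alternatingSum σ (λ τ → X ^ (plateau x y z + ap (y ∷ z ∷ τ)))
        ≈⟨ R.+-cong (^-congʳ X (ap-∷∷-double {x = x} y<m (z<m ∷ σ<m))) (R.-‿cong factor) ⟩
      X ^ suc (ap (z ∷ σ)) +ᴿ - (X ^ plateau x y z · tailSum y z σ) ∎
      where
      τs = insertions (double m) σ
      factor = begin
        ∑[ τ ∈ τs ] (X ^ (plateau x y z + ap (y ∷ z ∷ τ)) · sign τ)
          ≈⟨ ∑-cong τs (λ _ → R.trans (R.*-congʳ (^-homo-* X (plateau x y z) _)) (R.*-assoc _ _ _)) ⟩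
        ∑[ τ ∈ τs ] (X ^ plateau x y z · (X ^ ap (y ∷ z ∷ τ) · sign τ))
          ≈⟨ ∑-scale _ τs _ ⟩
        X ^ plateau x y z · tailSum y z σ ∎

    -- Gaps are removed two at a time. Their number `length σ + 1` stays odd, so the induction ends
    -- with a single gap rather than with complete cancellation.
    tailSum-even : ∀ k x {y σ} → length σ ≡ k * 2 → y < m → All (_< m) σ →
      tailSum x y σ ≈ X ^ suc (ap (y ∷ σ))
    tailSum-even zero x {y} {[]} _ y<m [] =
      R.trans (alternatingSum-[] λ τ → X ^ ap (x ∷ y ∷ τ)) (^-congʳ X (ap-∷∷-double {x = x} y<m []))
    tailSum-even (suc k) x {y} {z ∷ w ∷ σ} len y<m (z<m ∷ w<m ∷ σ<m) = begin
      tailSum x y (z ∷ w ∷ σ)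
        ≈⟨ tailSum-∷ x y<m z<m (w<m ∷ σ<m) ⟩
      X ^ suc (ap (z ∷ w ∷ σ)) +ᴿ - (X ^ plateau x y z · tailSum y z (w ∷ σ))
        ≈⟨ R.+-congˡ (R.-‿cong (R.*-congˡ (R.trans (tailSum-∷ y z<m w<m σ<m)
             (R.+-congˡ (R.-‿cong (R.*-congˡ
               (tailSum-even k z (suc-injective (suc-injective len)) w<m σ<m))))))) ⟩
      X ^ suc (ap (z ∷ w ∷ σ)) +ᴿ - (X ^ plateau x y z · (e +ᴿ - (X ^ plateau y z w · e)))
        ≈⟨ telescope (plateau-cases y z w) ⟩
      X ^ suc (ap (y ∷ z ∷ w ∷ σ)) ∎
      where
      e = X ^ suc (ap (w ∷ σ))

      telescope : (y < z × z ≡ w) ⊎ plateau y z w ≡ 0 →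
        X ^ suc (ap (z ∷ w ∷ σ)) +ᴿ - (X ^ plateau x y z · (e +ᴿ - (X ^ plateau y z w · e)))
          ≈ X ^ suc (plateau y z w + ap (z ∷ w ∷ σ))
      -- Without a plateau at `z` the bracket is `e` minus `e`; it vanishes together with the factor
      -- for the triple `x y z`.
      telescope (inj₂ none) rewrite none = begin
        a +ᴿ - (X ^ plateau x y z · (e +ᴿ - (1# · e)))
          ≈⟨ R.+-congˡ (R.-‿cong (R.*-congˡ (R.+-congˡ (R.-‿cong (R.*-identityˡ e))))) ⟩
        a +ᴿ - (X ^ plateau x y z · (e +ᴿ - e))
          ≈⟨ R.+-congˡ (R.-‿cong (R.trans (R.*-congˡ (R.-‿inverseʳ e)) (R.zeroʳ _))) ⟩
        a +ᴿ - 0#  ≈⟨ R.+-congˡ -0#≈0# ⟩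
        a +ᴿ 0#    ≈⟨ R.+-identityʳ a ⟩
        a          ∎
        where a = X ^ suc (ap (z ∷ w ∷ σ))
      -- Two plateaus cannot overlap, so the one at z excludes one at y.
      telescope (inj₁ (y<z , refl))
        rewrite plateau-ascent y<z | plateau-≢ x (<⇒≢ y<z) | ap-descent σ (<-irrefl (refl {x = z})) = begin
        e +ᴿ - (1# · (e +ᴿ - (X · 1# · e)))
          ≈⟨ R.+-congˡ (R.-‿cong (R.*-identityˡ _)) ⟩
        e +ᴿ - (e +ᴿ - (X · 1# · e))
          ≈⟨ R.+-congˡ (-‿+-comm _ _) ⟨
        e +ᴿ (- e +ᴿ - - (X · 1# · e))
          ≈⟨ R.+-assoc _ _ _ ⟨
        e +ᴿ - e +ᴿ - - (X · 1# · e)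
          ≈⟨ R.+-cong (R.-‿inverseʳ e) (-‿involutive _) ⟩
        0# +ᴿ X · 1# · e
          ≈⟨ R.+-identityˡ _ ⟩
        X · 1# · e
          ≈⟨ R.*-congʳ (R.*-identityʳ X) ⟩
        X · e ∎

    -- The first gap alone yields the value. In a nonempty word the second gap cancels against the
    -- sum over all later ones, evaluated by `tailSum-even`.
    alternatingSum-ap : ∀ k {σ} → length σ ≡ k * 2 → All (_< m) σ →
      alternatingSum σ (λ τ → X ^ ap τ) ≈ X ^ ap σ
    alternatingSum-ap zero    {[]}        _   []                = alternatingSum-[] λ τ → X ^ ap τ
    alternatingSum-ap (suc k) {x ∷ y ∷ σ} len (x<m ∷ y<m ∷ σ<m) = begin
      alternatingSum (x ∷ y ∷ σ) (λ τ → X ^ ap τ)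
        ≈⟨ alternatingSum-∷ (y ∷ σ) _ x<m ⟩
      X ^ ap (double m ++ x ∷ y ∷ σ) +ᴿ - alternatingSum (y ∷ σ) (λ τ → X ^ ap (x ∷ τ))
        ≈⟨ R.+-cong (^-congʳ X (ap-double (x<m ∷ y<m ∷ σ<m))) (R.-‿cong later) ⟩
      X ^ ap (x ∷ y ∷ σ) +ᴿ - 0#  ≈⟨ R.+-congˡ -0#≈0# ⟩
      X ^ ap (x ∷ y ∷ σ) +ᴿ 0#    ≈⟨ R.+-identityʳ _ ⟩
      X ^ ap (x ∷ y ∷ σ)          ∎
      where
      later : alternatingSum (y ∷ σ) (λ τ → X ^ ap (x ∷ τ)) ≈ 0#
      later = begin
        alternatingSum (y ∷ σ) (λ τ → X ^ ap (x ∷ τ))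
          ≈⟨ alternatingSum-∷ σ _ y<m ⟩
        X ^ ap (x ∷ double m ++ y ∷ σ) +ᴿ - tailSum x y σ
          ≈⟨ R.+-cong (^-congʳ X (ap-∷-double x<m (y<m ∷ σ<m)))
               (R.-‿cong (tailSum-even k x (suc-injective (suc-injective len)) y<m σ<m)) ⟩
        X ^ suc (ap (y ∷ σ)) +ᴿ - (X ^ suc (ap (y ∷ σ)))
          ≈⟨ R.-‿inverseʳ _ ⟩
        0# ∎

  -- The signed sum over Stirling permutations

  sign-double : ∀ n us {vs} → let τ = us ++ double (suc n) ++ vs in
    (- 1#) ^ even (suc n) τ ≈ (- 1#) ^ even n (us ++ vs) · sign (suc n) τ
  sign-double n us {vs} = begin
    (- 1#) ^ even (suc n) τ
      ≈⟨ ^-congʳ (- 1#) (even-double n us) ⟩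
    (- 1#) ^ (even n (us ++ vs) + bit (does (evenIndexed? τ (suc n))))
      ≈⟨ ^-homo-* (- 1#) (even n (us ++ vs)) _ ⟩
    (- 1#) ^ even n (us ++ vs) · (- 1#) ^ bit (does (evenIndexed? τ (suc n)))
      ≈⟨ R.*-congˡ (sign-even (firstPosition (suc n) τ)) ⟩
    (- 1#) ^ even n (us ++ vs) · sign (suc n) τ ∎
    where τ = us ++ double (suc n) ++ vs

  weight : ℕ → List ℕ → Carrier
  weight n σ = X ^ ap σ · (- 1#) ^ even n σ

  ∑-insertions : ∀ n {σ} → σ ∈ 𝒬 n →
    ∑ (insertions (double (suc n)) σ) (weight (suc n)) ≈ weight n σ
  ∑-insertions n {σ} σ∈ = begin
    ∑[ τ ∈ τs ] (X ^ ap τ · (- 1#) ^ even (suc n) τ)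
      ≈⟨ ∑-cong τs split ⟩
    ∑[ τ ∈ τs ] ((- 1#) ^ even n σ · (X ^ ap τ · sign (suc n) τ))
      ≈⟨ ∑-scale _ τs _ ⟩
    (- 1#) ^ even n σ · alternatingSum (suc n) σ (λ τ → X ^ ap τ)
      ≈⟨ R.*-congˡ (alternatingSum-ap (suc n) n length-σ (𝒬-bounded n σ∈)) ⟩
    (- 1#) ^ even n σ · X ^ ap σ
      ≈⟨ R.*-comm _ _ ⟩
    weight n σ ∎
    where
    τs = insertions (double (suc n)) σ

    length-σ : length σ ≡ n * 2
    length-σ = trans (↭-length (proj₁ (∈𝒬⁻ n σ∈))) ([]₂-length n)

    split : ∀ {τ} → τ ∈ τs → weight (suc n) τ ≈ (- 1#) ^ even n σ · (X ^ ap τ · sign (suc n) τ)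
    split τ∈ with ∈-insertions⁻ (double (suc n)) τ∈
    ... | us , vs , refl , refl = R.trans (R.*-congˡ (sign-double n us)) (x∙yz≈y∙xz _ _ _)

  ∑-𝒬 : ∀ n → ∑ (𝒬 n) (weight n) ≈ 1#
  -- The induction starts at order `0`, where the empty word is the only one and has weight
  -- `1# · 1#`.
  ∑-𝒬 zero    = R.trans (R.+-identityʳ _) (R.*-identityʳ _)
  ∑-𝒬 (suc n) = begin
    ∑ (𝒬 (suc n)) (weight (suc n))
      ≈⟨ ∑-↭ (weight (suc n)) (𝒬-suc n) ⟩
    ∑ (concatMap (insertions (double (suc n))) (𝒬 n)) (weight (suc n))
      ≈⟨ ∑-concatMap (insertions (double (suc n))) (𝒬 n) (weight (suc n)) ⟩
    ∑[ σ ∈ 𝒬 n ] ∑ (insertions (double (suc n)) σ) (weight (suc n))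
      ≈⟨ ∑-cong (𝒬 n) (∑-insertions n) ⟩
    ∑ (𝒬 n) (weight n)
      ≈⟨ ∑-𝒬 n ⟩
    1# ∎

  -- The signed sum over marked permutations

  -- The two sums are paired gap by gap. The hypothesis ranges over all prefixes so that it passes
  -- to `f ∘ (x ∷_)` in the induction.
  ∑-insertions-neg : {a b : A} (xs : List A) (f : List A → Carrier) →
    (∀ us vs → f (us ++ b ∷ vs) ≈ - f (us ++ a ∷ vs)) →
    ∑ (insertions (b ∷ []) xs) f ≈ - ∑ (insertions (a ∷ []) xs) f
  ∑-laterInsertions-neg : {a b : A} (xs : List A) (f : List A → Carrier) →
    (∀ us vs → f (us ++ b ∷ vs) ≈ - f (us ++ a ∷ vs)) →
    ∑ (laterInsertions (b ∷ []) xs) f ≈ - ∑ (laterInsertions (a ∷ []) xs) f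
  ∑-insertions-neg xs f neg = R.trans
    (R.+-cong (neg [] xs) (∑-laterInsertions-neg xs f neg)) (-‿+-comm _ _)
  ∑-laterInsertions-neg []       f neg = R.sym -0#≈0#
  ∑-laterInsertions-neg {a = a} {b} (x ∷ xs) f neg = begin
    ∑ (map (x ∷_) (insertions (b ∷ []) xs)) f    ≈⟨ ∑-map (x ∷_) (insertions (b ∷ []) xs) f ⟩
    ∑ (insertions (b ∷ []) xs) (f ∘ (x ∷_))      ≈⟨ ∑-insertions-neg xs (f ∘ (x ∷_)) (neg ∘ (x ∷_)) ⟩
    - ∑ (insertions (a ∷ []) xs) (f ∘ (x ∷_))    ≈⟨ R.-‿cong (∑-map (x ∷_) (insertions (a ∷ []) xs) f) ⟨
    - ∑ (map (x ∷_) (insertions (a ∷ []) xs)) f  ∎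

  markedWeight : MarkedWord → Carrier
  markedWeight π = X ^ asc π · (- 1#) ^ mark π

  markedWeight-true : ∀ m us vs →
    markedWeight (us ++ (m , true) ∷ vs) ≈ - markedWeight (us ++ (m , false) ∷ vs)
  markedWeight-true m us vs = begin
    markedWeight (us ++ (m , true) ∷ vs)
      ≈⟨ R.*-cong (^-congʳ X (asc-true m us)) (^-congʳ (- 1#) (mark-true m us)) ⟩
    X ^ asc π · (- 1# · (- 1#) ^ mark π)  ≈⟨ R.*-congˡ (-1*x≈-x _) ⟩
    X ^ asc π · - (- 1#) ^ mark π         ≈⟨ -‿distribʳ-* _ _ ⟨
    - markedWeight π                      ∎
    where π = us ++ (m , false) ∷ vs

  ∑-markedInsertions : ∀ m {π} → All ((_< m) ∘ proj₁) π →
    ∑ (markedInsertions m π) markedWeight ≈ markedWeight π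
  ∑-markedInsertions m {π} <m = begin
    ∑ (insertions (single m false) π ++ laterInsertions (single m true) π) markedWeight
      ≈⟨ ∑-++ (insertions (single m false) π) (laterInsertions (single m true) π) markedWeight ⟩
    markedWeight ((m , false) ∷ π) +ᴿ s +ᴿ ∑ (laterInsertions (single m true) π) markedWeight
      ≈⟨ R.+-congˡ (∑-laterInsertions-neg π markedWeight (markedWeight-true m)) ⟩
    markedWeight ((m , false) ∷ π) +ᴿ s +ᴿ - s
      ≈⟨ R.+-assoc _ _ _ ⟩
    markedWeight ((m , false) ∷ π) +ᴿ (s +ᴿ - s)
      -- A largest entry put in front is followed by a descent, if by anything, so the number of
      -- ascents is kept.
      ≈⟨ R.+-cong (R.*-congʳ (^-congʳ X (asc-∷-bounded {b = false} <m))) (R.-‿inverseʳ s) ⟩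
    markedWeight π +ᴿ 0#
      ≈⟨ R.+-identityʳ _ ⟩
    markedWeight π ∎
    where s = ∑ (laterInsertions (single m false) π) markedWeight

  ∑-𝔖̄ : ∀ n → ∑ (𝔖̄ n) markedWeight ≈ 1#
  ∑-𝔖̄ zero    = R.trans (R.+-identityʳ _) (R.*-identityʳ _)
  ∑-𝔖̄ (suc n) = begin
    ∑ (𝔖̄ (suc n)) markedWeight
      ≈⟨ ∑-↭ markedWeight (𝔖̄-suc n) ⟩
    ∑ (concatMap (markedInsertions (suc n)) (𝔖̄ n)) markedWeight
      ≈⟨ ∑-concatMap (markedInsertions (suc n)) (𝔖̄ n) markedWeight ⟩
    ∑[ π ∈ 𝔖̄ n ] ∑ (markedInsertions (suc n) π) markedWeight
      ≈⟨ ∑-cong (𝔖̄ n) (λ π∈ → ∑-markedInsertions (suc n) (𝔖̄-bounded n π∈)) ⟩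
    ∑ (𝔖̄ n) markedWeight
      ≈⟨ ∑-𝔖̄ n ⟩
    1# ∎

theorem2 : ∀ {c ℓ} (R : CommutativeRing c ℓ) (x : CommutativeRing.Carrier R) →
    let open RingNotation R in
    (n : ℕ) → n ≥ 1 →
    ((∑[ σ ∈ 𝒬 n ] (x ^ ap σ · (- 1#) ^ even n σ))
      ≈ (∑[ π ∈ 𝔖̄ n ] (x ^ asc π · (- 1#) ^ mark π)))
    × ((∑[ π ∈ 𝔖̄ n ] (x ^ asc π · (- 1#) ^ mark π)) ≈ 1#)
theorem2 R x n _ = R.trans (∑-𝒬 n) (R.sym (∑-𝔖̄ n)) , ∑-𝔖̄ n
  where
  module R = CommutativeRing R
  open Sums R x
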